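{- Let $p$ be an odd prime with $p\equiv 3 \pmod 4$. Then $D_{Q_p,\mathbf 1}=5$.
   Context: For an odd prime $p$, $\mathbb Z_p=\mathbb Z/p\mathbb Z$, $U(p)$ is its group of units, and $Q_p=\{x^2:x\in U(p)\}$. A sequence of length $k$ in $\mathbb Z_p$ is an element of $\mathbb Z_p^k$. A sequence $(x_1,\ldots,x_k)$ in $\mathbb Z_p$ is called a $(Q_p,\mathbf 1)$-weighted zero-sum sequence if there exist $a_1,\ldots,a_k\in Q_p$ such that $a_1x_1+\cdots+a_kx_k=0$ and $a_1+\cdots+a_k=0$ in $\mathbb Z_p$. The constant $D_{Q_p,\mathbf 1}$ is the least positive integer $k$ such that every sequence in $\mathbb Z_p$ of length $k$ has a (non-empty) $(Q_p,\mathbf 1)$-weighted zero-sum subsequence (terms not necessarily consecutive). -}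

module Defs where

open import Data.Nat.Base as ℕ using (ℕ; NonZero; _≤_)
open import Data.Nat.DivMod using (_mod_)
open import Data.Fin.Base using (Fin; toℕ)
open import Data.List.Relation.Binary.Sublist.Propositional using (_⊆_)
open import Data.Product.Base using (∃; _×_)
open import Data.Vec.Base using (Vec; foldr′; zipWith; toList)
open import Data.Vec.Relation.Unary.All using (All)
open import Relation.Binary.PropositionalEquality.Core using (_≡_)

-- Integers modulo p, represented by their least non-negative residues, so
-- that equality in ℤ/pℤ is propositional equality.
module Mod (p : ℕ) .{{_ : NonZero p}} where

  ℤₚ : Set
  ℤₚ = Fin p

  infixl 6 _+_
  infixl 7 _*_

  _+_ _*_ : ℤₚ → ℤₚ → ℤₚ
  x + y = (toℕ x ℕ.+ toℕ y) mod p
  x * y = (toℕ x ℕ.* toℕ y) mod p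

  0# 1# : ℤₚ
  0# = 0 mod p
  1# = 1 mod p

  sum : ∀ {k} → Vec ℤₚ k → ℤₚ
  sum = foldr′ _+_ 0#

  U : ℤₚ → Set
  U x = ∃ λ y → x * y ≡ 1#

  Q : ℤₚ → Set
  Q a = ∃ λ x → U x × a ≡ x * x

  IsWeightedZeroSum : ∀ {k} → Vec ℤₚ k → Set
  IsWeightedZeroSum {k} xs =
    ∃ λ (as : Vec ℤₚ k) →
      All Q as × sum (zipWith _*_ as xs) ≡ 0# × sum as ≡ 0#

  -- The relation _⊆_ on lists is the order-preserving, not necessarily
  -- contiguous, sublist relation.
  HasWeightedZeroSumSubsequence : ∀ {k} → Vec ℤₚ k → Set
  HasWeightedZeroSumSubsequence xs =
    ∃ λ m → ∃ λ (ys : Vec ℤₚ m) →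
      1 ≤ m × toList ys ⊆ toList xs × IsWeightedZeroSum ys

  EverySequenceOfLength : ℕ → Set
  EverySequenceOfLength k =
    (xs : Vec ℤₚ k) → HasWeightedZeroSumSubsequence xs

  -- IsD d states that the least positive k satisfying
  -- EverySequenceOfLength k exists and equals d.
  IsD : ℕ → Set
  IsD d =
    1 ≤ d × EverySequenceOfLength d ×
    (∀ k → 1 ≤ k → EverySequenceOfLength k → d ≤ k)

{-# OPTIONS --safe #-}
module Submission where

-- Writing the weights as squares, and giving weight 0 to the omitted terms, a
-- weighted zero-sum subsequence of x₁, …, x_k is a non-trivial common zero v of the
-- quadratic forms Σ vᵢ² xᵢ and Σ vᵢ².  The degrees add up to 4, so for k = 5 one
-- exists by Chevalley–Warning.  For (0, 0, 1, 1) a common zero satisfies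
-- v₁² + v₂² = 0 = v₃² + v₄², hence vanishes, since −1 is not a square modulo
-- p ≡ 3 (mod 4).

open import Defs
open import Algebra.Bundles using (CommutativeRing; Semiring)
open import Algebra.Core using (Op₁; Op₂)
open import Algebra.Structures using (IsCommutativeRing)
import Algebra.Definitions.RawMonoid as RawMonoidMult
import Algebra.Consequences.Propositional as Consequences
import Algebra.Definitions.RawSemiring as RawSemiring
import Algebra.Properties.CommutativeMonoid.Sum as CommutativeMonoidSum
import Algebra.Properties.Ring as RingProperties
import Algebra.Properties.Semiring.Exp as SemiringExp
import Algebra.Properties.Semiring.Sum as SemiringSum
open import Data.Fin.Base using (Fin; zero; suc; toℕ)
open import Data.Fin.Permutation using (Permutation′; permutation)
open import Data.Fin.Properties using (toℕ-injective; toℕ-fromℕ<; toℕ<n; any?; _≟_)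
open import Data.List.Relation.Binary.Sublist.Propositional using (_⊆_; []; _∷_; _∷ʳ_)
open import Data.Nat.Base as ℕ
  using (ℕ; zero; suc; 2+; NonZero; _%_; _∸_; _≤_; _<_; z≤n; s≤s; _≤′_; ≤′-refl; ≤′-step)
open import Data.Nat.Coprimality using (prime⇒coprime; coprime-Bézout)
open import Data.Nat.Divisibility using (_∣_)
open import Data.Nat.DivMod
  using (_mod_; %-distribˡ-+; %-distribˡ-*; m<n⇒m%n≡m; [m+n]%n≡m%n;
         [m+kn]%n≡m%n; m*n%n≡0; m≡m%n+[m/n]*n; _/_)
open import Data.Nat.GCD using (module Bézout)
open import Data.Nat.Primality using (Prime; ¬prime[0]; ¬prime[1])
import Data.Nat.Properties as ℕ
open import Data.Product.Base using (∃; _×_; _,_)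
open import Data.Vec.Base as Vec using (Vec; []; _∷_; lookup; replicate; toList; zipWith; _[_]%=_)
open import Data.Vec.Properties using (≡-dec; ∷-injectiveˡ; ∷-injectiveʳ)
open import Data.Vec.Relation.Unary.All using (All; []; _∷_)
open import Function.Base using (_∘_)
open import Level using (0ℓ)
open import Relation.Binary.PropositionalEquality
open import Relation.Nullary.Decidable using (Dec; yes; no; map′; ¬?; _×-dec_; decidable-stable)
open import Relation.Nullary.Negation using (¬_; contradiction)

-- The commutative ring of residues modulo `p`.

module Residues (p : ℕ) .{{_ : NonZero p}} where

  open Mod p
  open ≡-Reasoning

  ⟦_⟧ : ℕ → ℤₚ
  ⟦ m ⟧ = m mod p

  toℕ-mod : ∀ m → toℕ ⟦ m ⟧ ≡ m % p
  toℕ-mod m = toℕ-fromℕ< _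

  mod-cong : ∀ m n → m % p ≡ n % p → ⟦ m ⟧ ≡ ⟦ n ⟧
  mod-cong m n eq = toℕ-injective (trans (toℕ-mod m) (trans eq (sym (toℕ-mod n))))

  toℕ-mod-id : ∀ x → ⟦ toℕ x ⟧ ≡ x
  toℕ-mod-id x = toℕ-injective (trans (toℕ-mod (toℕ x)) (m<n⇒m%n≡m (toℕ<n x)))

  +-homo : ∀ m n → ⟦ m ℕ.+ n ⟧ ≡ ⟦ m ⟧ + ⟦ n ⟧
  +-homo m n = mod-cong (m ℕ.+ n) _ (begin
    (m ℕ.+ n) % p                              ≡⟨ %-distribˡ-+ m n p ⟩
    (m % p ℕ.+ n % p) % p                      ≡⟨ cong₂ (λ a b → (a ℕ.+ b) % p)
                                                       (toℕ-mod m) (toℕ-mod n) ⟨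
    (toℕ ⟦ m ⟧ ℕ.+ toℕ ⟦ n ⟧) % p              ∎)

  *-homo : ∀ m n → ⟦ m ℕ.* n ⟧ ≡ ⟦ m ⟧ * ⟦ n ⟧
  *-homo m n = mod-cong (m ℕ.* n) _ (begin
    (m ℕ.* n) % p                              ≡⟨ %-distribˡ-* m n p ⟩
    (m % p ℕ.* (n % p)) % p                    ≡⟨ cong₂ (λ a b → (a ℕ.* b) % p)
                                                       (toℕ-mod m) (toℕ-mod n) ⟨
    (toℕ ⟦ m ⟧ ℕ.* toℕ ⟦ n ⟧) % p              ∎)

  -- Reducing an operand before the outer operation makes no difference. With the three companions
  -- below, this lets the ring laws descend from ℕ.
  +-absorbˡ : ∀ m z → ⟦ m ⟧ + z ≡ ⟦ m ℕ.+ toℕ z ⟧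
  +-absorbˡ m z = trans (cong (⟦ m ⟧ +_) (sym (toℕ-mod-id z))) (sym (+-homo m (toℕ z)))

  +-absorbʳ : ∀ x n → x + ⟦ n ⟧ ≡ ⟦ toℕ x ℕ.+ n ⟧
  +-absorbʳ x n = trans (cong (_+ ⟦ n ⟧) (sym (toℕ-mod-id x))) (sym (+-homo (toℕ x) n))

  *-absorbˡ : ∀ m z → ⟦ m ⟧ * z ≡ ⟦ m ℕ.* toℕ z ⟧
  *-absorbˡ m z = trans (cong (⟦ m ⟧ *_) (sym (toℕ-mod-id z))) (sym (*-homo m (toℕ z)))

  *-absorbʳ : ∀ x n → x * ⟦ n ⟧ ≡ ⟦ toℕ x ℕ.* n ⟧
  *-absorbʳ x n = trans (cong (_* ⟦ n ⟧) (sym (toℕ-mod-id x))) (sym (*-homo (toℕ x) n))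

  -- At 0 the representative is `p` itself, which reduces to 0.
  -_ : ℤₚ → ℤₚ
  - x = ⟦ p ∸ toℕ x ⟧

  +-comm : ∀ x y → x + y ≡ y + x
  +-comm x y = cong ⟦_⟧ (ℕ.+-comm (toℕ x) (toℕ y))

  +-assoc : ∀ x y z → (x + y) + z ≡ x + (y + z)
  +-assoc x y z = begin
    (x + y) + z                                ≡⟨ +-absorbˡ _ z ⟩
    ⟦ toℕ x ℕ.+ toℕ y ℕ.+ toℕ z ⟧              ≡⟨ cong ⟦_⟧ (ℕ.+-assoc (toℕ x) (toℕ y) (toℕ z)) ⟩
    ⟦ toℕ x ℕ.+ (toℕ y ℕ.+ toℕ z) ⟧            ≡⟨ +-absorbʳ x _ ⟨
    x + (y + z)                                ∎

  +-identityˡ : ∀ x → 0# + x ≡ x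
  +-identityˡ x = trans (+-absorbˡ 0 x) (toℕ-mod-id x)

  +-inverseˡ : ∀ x → - x + x ≡ 0#
  +-inverseˡ x = begin
    - x + x                                    ≡⟨ +-absorbˡ _ x ⟩
    ⟦ p ∸ toℕ x ℕ.+ toℕ x ⟧                    ≡⟨ cong ⟦_⟧ (ℕ.m∸n+n≡m (ℕ.<⇒≤ (toℕ<n x))) ⟩
    ⟦ p ⟧                                      ≡⟨ mod-cong p 0 ([m+n]%n≡m%n 0 p) ⟩
    0#                                         ∎

  *-comm : ∀ x y → x * y ≡ y * x
  *-comm x y = cong ⟦_⟧ (ℕ.*-comm (toℕ x) (toℕ y))

  *-assoc : ∀ x y z → (x * y) * z ≡ x * (y * z)
  *-assoc x y z = begin
    (x * y) * z                                ≡⟨ *-absorbˡ _ z ⟩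
    ⟦ toℕ x ℕ.* toℕ y ℕ.* toℕ z ⟧              ≡⟨ cong ⟦_⟧ (ℕ.*-assoc (toℕ x) (toℕ y) (toℕ z)) ⟩
    ⟦ toℕ x ℕ.* (toℕ y ℕ.* toℕ z) ⟧            ≡⟨ *-absorbʳ x _ ⟨
    x * (y * z)                                ∎

  *-identityˡ : ∀ x → 1# * x ≡ x
  *-identityˡ x = begin
    1# * x                                     ≡⟨ *-absorbˡ 1 x ⟩
    ⟦ 1 ℕ.* toℕ x ⟧                            ≡⟨ cong ⟦_⟧ (ℕ.*-identityˡ (toℕ x)) ⟩
    ⟦ toℕ x ⟧                                  ≡⟨ toℕ-mod-id x ⟩
    x                                          ∎

  *-distribˡ-+ : ∀ x y z → x * (y + z) ≡ x * y + x * z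
  *-distribˡ-+ x y z = begin
    x * (y + z)                                ≡⟨ *-absorbʳ x _ ⟩
    ⟦ toℕ x ℕ.* (toℕ y ℕ.+ toℕ z) ⟧            ≡⟨ cong ⟦_⟧ (ℕ.*-distribˡ-+ (toℕ x) (toℕ y) (toℕ z)) ⟩
    ⟦ toℕ x ℕ.* toℕ y ℕ.+ toℕ x ℕ.* toℕ z ⟧    ≡⟨ +-homo (toℕ x ℕ.* toℕ y) (toℕ x ℕ.* toℕ z) ⟩
    x * y + x * z                              ∎

  commutativeRing : CommutativeRing 0ℓ 0ℓ
  commutativeRing = record
    { Carrier = ℤₚ ; _≈_ = _≡_ ; _+_ = _+_ ; _*_ = _*_ ; -_ = -_ ; 0# = 0# ; 1# = 1#
    ; isCommutativeRing = record
      { isRing = record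
        { +-isAbelianGroup = record
          { isGroup = record
            { isMonoid = record
              { isSemigroup = record
                { isMagma = record { isEquivalence = isEquivalence ; ∙-cong = cong₂ _+_ }
                ; assoc = +-assoc
                }
              ; identity = Consequences.comm∧idˡ⇒id +-comm +-identityˡ
              }
            ; inverse = Consequences.comm∧invˡ⇒inv +-comm +-inverseˡ
            ; ⁻¹-cong = cong -_
            }
          ; comm = +-comm
          }
        ; *-cong = cong₂ _*_
        ; *-assoc = *-assoc
        ; *-identity = Consequences.comm∧idˡ⇒id *-comm *-identityˡ
        ; distrib = Consequences.comm∧distrˡ⇒distr (cong₂ _+_) *-comm *-distribˡ-+
        }
      ; *-comm = *-comm
      }
    }

-- Inverses and characteristic for a prime modulus.

module PrimeResidues (n : ℕ) (prime : Prime (2+ n)) where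

  p : ℕ
  p = 2+ n

  open Residues p
  open CommutativeRing commutativeRing
    using (_+_; _*_; 0#; 1#; ring; semiring; zeroˡ; zeroʳ; distribʳ)
  open RingProperties ring using (-‿distribʳ-*; +-inverseˡ-unique)
  open RawSemiring (Semiring.rawSemiring semiring) using () renaming (_×_ to _×′_)
  open ≡-Reasoning

  -- Bézout's identity for `p` and `x` over ℕ comes in two forms. From 1 + b x = a p the inverse is
  -- -b; from 1 + a p = b x it is b.
  inverse : ∀ x → x ≢ 0# → ∃ λ y → x * y ≡ 1#
  inverse zero      x≢0 = contradiction refl x≢0
  inverse x@(suc i) _ with coprime-Bézout (prime⇒coprime prime (toℕ<n x))
  ... | Bézout.+- a b eq = - ⟦ b ⟧ , (begin
    x * - ⟦ b ⟧                   ≡⟨ -‿distribʳ-* x ⟦ b ⟧ ⟨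
    - (x * ⟦ b ⟧)                 ≡⟨ cong -_ (*-comm x ⟦ b ⟧) ⟩
    - (⟦ b ⟧ * x)                 ≡⟨ +-inverseˡ-unique 1# (⟦ b ⟧ * x) 1+bx≡0 ⟨
    1#                            ∎)
    where
    1+bx≡0 : 1# + ⟦ b ⟧ * x ≡ 0#
    1+bx≡0 = begin
      1# + ⟦ b ⟧ * x              ≡⟨ cong (1# +_) (*-absorbˡ b x) ⟩
      ⟦ 1 ⟧ + ⟦ b ℕ.* toℕ x ⟧     ≡⟨ +-homo 1 (b ℕ.* toℕ x) ⟨
      ⟦ 1 ℕ.+ b ℕ.* toℕ x ⟧       ≡⟨ cong ⟦_⟧ eq ⟩
      ⟦ a ℕ.* p ⟧                 ≡⟨ mod-cong (a ℕ.* p) 0 (m*n%n≡0 a p) ⟩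
      0#                          ∎
  ... | Bézout.-+ a b eq = ⟦ b ⟧ , (begin
    x * ⟦ b ⟧                     ≡⟨ *-comm x ⟦ b ⟧ ⟩
    ⟦ b ⟧ * x                     ≡⟨ *-absorbˡ b x ⟩
    ⟦ b ℕ.* toℕ x ⟧               ≡⟨ cong ⟦_⟧ eq ⟨
    ⟦ 1 ℕ.+ a ℕ.* p ⟧             ≡⟨ mod-cong (1 ℕ.+ a ℕ.* p) 1 ([m+kn]%n≡m%n 1 a p) ⟩
    1#                            ∎)

  ×′-⟦⟧ : ∀ k x → k ×′ x ≡ ⟦ k ⟧ * x
  ×′-⟦⟧ zero    x = sym (zeroˡ x)
  ×′-⟦⟧ (suc k) x = begin
    x + k ×′ x                    ≡⟨ cong₂ _+_ (sym (*-identityˡ x)) (×′-⟦⟧ k x) ⟩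
    1# * x + ⟦ k ⟧ * x            ≡⟨ distribʳ x 1# ⟦ k ⟧ ⟨
    (1# + ⟦ k ⟧) * x              ≡⟨ cong (_* x) (+-homo 1 k) ⟨
    ⟦ suc k ⟧ * x                 ∎

  ⟦suc⟧≢0 : ∀ {k} → suc k < p → ⟦ suc k ⟧ ≢ 0#
  ⟦suc⟧≢0 {k} k<p eq = contradiction
    (trans (sym (m<n⇒m%n≡m k<p)) (trans (sym (toℕ-mod (suc k))) (cong toℕ eq))) λ ()

  -- A positive integer below `p` is a unit modulo `p`, so it can be cancelled from a multiple.
  characteristic : ∀ {k x} → suc k < p → suc k ×′ x ≡ 0# → x ≡ 0#
  characteristic {k} {x} k<p eq with z , kz≡1 ← inverse ⟦ suc k ⟧ (⟦suc⟧≢0 k<p) = begin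
    x                             ≡⟨ *-identityˡ x ⟨
    1# * x                        ≡⟨ cong (_* x) (trans (*-comm z _) kz≡1) ⟨
    z * ⟦ suc k ⟧ * x             ≡⟨ *-assoc z _ x ⟩
    z * (⟦ suc k ⟧ * x)           ≡⟨ cong (z *_) (trans (sym (×′-⟦⟧ (suc k) x)) eq) ⟩
    z * 0#                        ≡⟨ zeroʳ z ⟩
    0#                            ∎

-- Fields of prime order, presented abstractly.

fromIsCommutativeRing : ∀ {A : Set} {_+_ _*_ : Op₂ A} { -_ : Op₁ A} {0# 1# : A} →
                        IsCommutativeRing _≡_ _+_ _*_ -_ 0# 1# → CommutativeRing 0ℓ 0ℓ
fromIsCommutativeRing isCommutativeRing = record { isCommutativeRing = isCommutativeRing }

-- A field of prime order p is given by operations on Fin p, so that sums over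
-- its elements are sums over Fin p.
module FiniteField
  {n : ℕ} {_⊕_ _⊗_ : Op₂ (Fin (2+ n))} {⊖_ : Op₁ (Fin (2+ n))} {one : Fin (2+ n)}
  (isCommutativeRing : IsCommutativeRing _≡_ _⊕_ _⊗_ ⊖_ zero one)
  (1≢0 : one ≢ zero)
  (inverse : ∀ x → x ≢ zero → ∃ λ y → x ⊗ y ≡ one)
  (characteristic : ∀ {k x} → suc k < 2+ n →
                    RawMonoidMult._×_ (CommutativeRing.+-rawMonoid
                      (fromIsCommutativeRing isCommutativeRing)) (suc k) x ≡ zero →
                    x ≡ zero)
  where

  ℤₚ : Set
  ℤₚ = Fin (2+ n)

  p p-1 : ℕ
  p = 2+ n
  p-1 = suc n

  open CommutativeRing (fromIsCommutativeRing isCommutativeRing) public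
    hiding (refl; sym; trans; Carrier; setoid; isEquivalence; reflexive; _≉_; zero; isCommutativeRing)
  open RingProperties ring using (+-cancelˡ)
  open RawSemiring (Semiring.rawSemiring semiring) using (_^_) renaming (_×_ to _×′_)
  open SemiringExp semiring using (^-assocʳ)
  open CommutativeMonoidSum +-commutativeMonoid
    using (sum; sum-cong-≗; ∑-distrib-+; sum-permute; sum-replicate-zero)
  module Product = CommutativeMonoidSum *-commutativeMonoid
  open SemiringSum semiring using (*-distribˡ-sum; *-distribʳ-sum)
  open ≡-Reasoning

  -- Cancellation and Fermat's little theorem.

  *-swap : ∀ x y z → x * (y * z) ≡ y * (x * z)
  *-swap x y z = trans (sym (*-assoc x y z)) (trans (cong (_* z) (*-comm x y)) (*-assoc y x z))

  *-cancelˡ : ∀ x {y z} → x ≢ 0# → x * y ≡ x * z → y ≡ z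
  *-cancelˡ x {y} {z} x≢0 eq with x⁻¹ , xx⁻¹≡1 ← inverse x x≢0 = begin
    y                             ≡⟨ unit y ⟨
    x⁻¹ * (x * y)                 ≡⟨ cong (x⁻¹ *_) eq ⟩
    x⁻¹ * (x * z)                 ≡⟨ unit z ⟩
    z                             ∎
    where
    unit : ∀ w → x⁻¹ * (x * w) ≡ w
    unit w = begin
      x⁻¹ * (x * w)               ≡⟨ *-assoc x⁻¹ x w ⟨
      x⁻¹ * x * w                 ≡⟨ cong (_* w) (trans (*-comm x⁻¹ x) xx⁻¹≡1) ⟩
      1# * w                      ≡⟨ *-identityˡ w ⟩
      w                           ∎

  x*y≡0⇒y≡0 : ∀ {x y} → x ≢ 0# → x * y ≡ 0# → y ≡ 0#
  x*y≡0⇒y≡0 {x} x≢0 eq = *-cancelˡ x x≢0 (trans eq (sym (zeroʳ x)))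

  -- Fermat: multiplication by x permutes the residues.  The weight is y for
  -- y ≢ 0 and 1 for y ≡ 0, so that its product over all residues is non-zero.
  weight : ℤₚ → ℤₚ
  weight zero      = 1#
  weight y@(suc _) = y

  weight-≢0 : ∀ {y} → y ≢ 0# → weight y ≡ y
  weight-≢0 {zero}  y≢0 = contradiction refl y≢0
  weight-≢0 {suc _} _   = refl

  product-≢0 : ∀ {k} (f : Fin k → ℤₚ) → (∀ i → f i ≢ 0#) → Product.sum f ≢ 0#
  product-≢0 {zero}  f f≢0 = 1≢0
  product-≢0 {suc k} f f≢0 = product-≢0 (f ∘ suc) (f≢0 ∘ suc) ∘ x*y≡0⇒y≡0 (f≢0 zero)

  scaling : ∀ x → x ≢ 0# → Permutation′ p
  scaling x x≢0 with x⁻¹ , xx⁻¹≡1 ← inverse x x≢0 =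
    permutation (x *_) (x⁻¹ *_)
      (λ y → cancel xx⁻¹≡1 y)
      (λ y → cancel (trans (*-comm x⁻¹ x) xx⁻¹≡1) y)
    where
    cancel : ∀ {a b} → a * b ≡ 1# → ∀ y → a * (b * y) ≡ y
    cancel {a} {b} ab≡1 y =
      trans (sym (*-assoc a b y)) (trans (cong (_* y) ab≡1) (*-identityˡ y))

  fermat : ∀ x → x ≢ 0# → x ^ p-1 ≡ 1#
  fermat x x≢0 = *-cancelˡ W W≢0 (begin
    W * x ^ p-1                             ≡⟨ *-comm W (x ^ p-1) ⟩
    x ^ p-1 * W                             ≡⟨ cong (_* W) (Product.sum-replicate p-1) ⟨
    Product.sum (λ (_ : Fin p-1) → x) * W   ≡⟨ cong (_* W) (*-identityˡ _) ⟨
    Product.sum c * W                       ≡⟨ Product.∑-distrib-+ c weight ⟨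
    Product.sum (λ y → c y * weight y)      ≡⟨ Product.sum-cong-≗ scaled ⟨
    Product.sum (λ y → weight (x * y))      ≡⟨ Product.sum-permute weight (scaling x x≢0) ⟨
    W                                       ≡⟨ *-identityʳ W ⟨
    W * 1#                                  ∎)
    where
    W = Product.sum weight

    -- Scaling by `x` multiplies the weight of each non-zero residue by `x` and leaves the weight 1
    -- of 0 alone. The product of these factors is therefore `x` to the power `p-1`, not `p`.
    c : ℤₚ → ℤₚ
    c zero    = 1#
    c (suc _) = x

    W≢0 : W ≢ 0#
    W≢0 = product-≢0 weight λ { zero → 1≢0 ; (suc _) () }

    scaled : ∀ y → weight (x * y) ≡ c y * weight y
    scaled zero      = trans (cong weight (zeroʳ x)) (sym (*-identityˡ 1#))
    scaled y@(suc _) = weight-≢0 λ eq → contradiction (x*y≡0⇒y≡0 x≢0 eq) λ ()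

  -- Power sums over the field.

  translation : Permutation′ p
  translation = permutation (_+ 1#) (_+ - 1#)
    (λ y → cancel (- 1#) 1# (-‿inverseˡ 1#) y)
    (λ y → cancel 1# (- 1#) (-‿inverseʳ 1#) y)
    where
    cancel : ∀ a b → a + b ≡ 0# → ∀ y → y + a + b ≡ y
    cancel a b a+b≡0 y =
      trans (+-assoc y a b) (trans (cong (y +_) a+b≡0) (+-identityʳ y))

  -- This two-parameter family yields the power sums T 0 b without binomial
  -- coefficients.
  T : ℕ → ℕ → ℤₚ
  T a b = sum λ y → (y + 1#) ^ a * y ^ b

  -- Splitting off one factor `y + 1#` takes the place of Pascal's rule.
  T-suc : ∀ a b → T (suc a) b ≡ T a (suc b) + T a b
  T-suc a b = trans (sum-cong-≗ step)
    (∑-distrib-+ (λ y → (y + 1#) ^ a * (y * y ^ b)) (λ y → (y + 1#) ^ a * y ^ b))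
    where
    step : ∀ y → (y + 1#) * (y + 1#) ^ a * y ^ b ≡
                 (y + 1#) ^ a * (y * y ^ b) + (y + 1#) ^ a * y ^ b
    step y = begin
      (y + 1#) * z * w            ≡⟨ *-assoc (y + 1#) z w ⟩
      (y + 1#) * (z * w)          ≡⟨ distribʳ (z * w) y 1# ⟩
      y * (z * w) + 1# * (z * w)  ≡⟨ cong₂ _+_ (*-swap y z w) (*-identityˡ _) ⟩
      z * (y * w) + z * w         ∎
      where
      z = (y + 1#) ^ a
      w = y ^ b

  T-shift : ∀ k → T k 0 ≡ T 0 k
  T-shift k = begin
    sum (λ y → (y + 1#) ^ k * 1#) ≡⟨ sum-cong-≗ (λ y → *-identityʳ ((y + 1#) ^ k)) ⟩
    sum (λ y → (y + 1#) ^ k)      ≡⟨ sum-permute (_^ k) translation ⟨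
    sum (_^ k)                    ≡⟨ sum-cong-≗ (λ y → *-identityˡ (y ^ k)) ⟨
    T 0 k                         ∎

  -- Once T vanishes on the antidiagonal N − 1, it is constant, say t, on the
  -- antidiagonal N; then T (N + 1) 0 = T 0 (N + 1) + (N + 1) t by T-suc, and
  -- the shift y ↦ y + 1 gives (N + 1) t = 0.
  T-vanishes : ∀ N → N < p-1 → ∀ a b → a ℕ.+ b ≡ N → T a b ≡ 0#
  T-vanishes N N<p-1 a b a+b≡N = trans (constant a b a+b≡N) (characteristic (s≤s N<p-1) vanish)
    where
    -- The recursion on `N`; for `N` = 0 there is no earlier antidiagonal and the claim is vacuous.
    previous : ∀ a b → suc (a ℕ.+ b) ≡ N → T a b ≡ 0#
    previous a b refl = T-vanishes (a ℕ.+ b) (ℕ.<-trans (ℕ.n<1+n _) N<p-1) a b refl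

    constant : ∀ a b → a ℕ.+ b ≡ N → T a b ≡ T 0 N
    constant zero    b refl = refl
    constant (suc a) b eq   = begin
      T (suc a) b                 ≡⟨ T-suc a b ⟩
      T a (suc b) + T a b         ≡⟨ cong₂ _+_ (constant a (suc b) (trans (ℕ.+-suc a b) eq))
                                               (previous a b eq) ⟩
      T 0 N + 0#                  ≡⟨ +-identityʳ _ ⟩
      T 0 N                       ∎

    next : ∀ a b → a ℕ.+ b ≡ suc N → T a b ≡ T 0 (suc N) + a ×′ T 0 N
    next zero    b refl = sym (+-identityʳ _)
    next (suc a) b eq   = begin
      T (suc a) b                            ≡⟨ T-suc a b ⟩
      T a (suc b) + T a b                    ≡⟨ cong₂ _+_ (next a (suc b) (trans (ℕ.+-suc a b) eq))
                                                          (constant a b (ℕ.suc-injective eq)) ⟩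
      T 0 (suc N) + a ×′ T 0 N + T 0 N       ≡⟨ +-assoc _ _ _ ⟩
      T 0 (suc N) + (a ×′ T 0 N + T 0 N)     ≡⟨ cong (T 0 (suc N) +_) (+-comm _ _) ⟩
      T 0 (suc N) + suc a ×′ T 0 N           ∎

    vanish : suc N ×′ T 0 N ≡ 0#
    vanish = +-cancelˡ (T 0 (suc N)) _ _ (begin
      T 0 (suc N) + suc N ×′ T 0 N           ≡⟨ next (suc N) 0 (ℕ.+-identityʳ _) ⟨
      T (suc N) 0                            ≡⟨ T-shift (suc N) ⟩
      T 0 (suc N)                            ≡⟨ +-identityʳ _ ⟨
      T 0 (suc N) + 0#                       ∎)

  -- The bound is sharp: by Fermat, the sum for the exponent `p-1` is -1.
  power-sum : ∀ {k} → k < p-1 → sum (_^ k) ≡ 0#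
  power-sum {k} k<p-1 =
    trans (sum-cong-≗ λ y → sym (*-identityˡ (y ^ k))) (T-vanishes k k<p-1 0 k refl)

  -- Sums over all vectors.

  ∑ᵛ : ∀ {k} → (Vec ℤₚ k → ℤₚ) → ℤₚ
  ∑ᵛ {zero}  F = F []
  ∑ᵛ {suc k} F = sum λ y → ∑ᵛ λ v → F (y ∷ v)

  ∑ᵛ-cong : ∀ {k} {F G : Vec ℤₚ k → ℤₚ} → F ≗ G → ∑ᵛ F ≡ ∑ᵛ G
  ∑ᵛ-cong {zero}  eq = eq []
  ∑ᵛ-cong {suc k} eq = sum-cong-≗ λ y → ∑ᵛ-cong λ v → eq (y ∷ v)

  ∑ᵛ-+ : ∀ {k} (F G : Vec ℤₚ k → ℤₚ) → ∑ᵛ (λ v → F v + G v) ≡ ∑ᵛ F + ∑ᵛ G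
  ∑ᵛ-+ {zero}  F G = refl
  ∑ᵛ-+ {suc k} F G =
    trans (sum-cong-≗ λ y → ∑ᵛ-+ (F ∘ (y ∷_)) (G ∘ (y ∷_)))
      (∑-distrib-+ (λ y → ∑ᵛ (F ∘ (y ∷_))) (λ y → ∑ᵛ (G ∘ (y ∷_))))

  ∑ᵛ-* : ∀ {k} c (F : Vec ℤₚ k → ℤₚ) → ∑ᵛ (λ v → c * F v) ≡ c * ∑ᵛ F
  ∑ᵛ-* {zero}  c F = refl
  ∑ᵛ-* {suc k} c F =
    trans (sum-cong-≗ λ y → ∑ᵛ-* c (F ∘ (y ∷_))) (sym (*-distribˡ-sum c λ y → ∑ᵛ (F ∘ (y ∷_))))

  ∑ᵛ-0 : ∀ {k} {F : Vec ℤₚ k → ℤₚ} → (∀ v → F v ≡ 0#) → ∑ᵛ F ≡ 0#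
  ∑ᵛ-0 {zero}  F≡0 = F≡0 []
  ∑ᵛ-0 {suc k} F≡0 =
    trans (sum-cong-≗ λ y → ∑ᵛ-0 λ v → F≡0 (y ∷ v)) (sum-replicate-zero p)

  0ᵛ 1ᵛ : ∀ {k} → Vec ℤₚ k
  0ᵛ = replicate _ 0#
  1ᵛ = replicate _ 1#

  ∑ᵛ-supported-at-0 : ∀ {k} {F : Vec ℤₚ k → ℤₚ} →
                      (∀ v → v ≢ 0ᵛ → F v ≡ 0#) → ∑ᵛ F ≡ F 0ᵛ
  ∑ᵛ-supported-at-0 {zero}      supp = refl
  ∑ᵛ-supported-at-0 {suc k} {F} supp = begin
    ∑ᵛ (F ∘ (zero ∷_)) + sum (λ i → ∑ᵛ (F ∘ (suc i ∷_)))
      ≡⟨ cong₂ _+_ (∑ᵛ-supported-at-0 λ v v≢0 → supp (zero ∷ v) λ { refl → v≢0 refl })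
                   (sum-cong-≗ λ i → ∑ᵛ-0 λ v → supp (suc i ∷ v) λ ()) ⟩
    F 0ᵛ + sum (λ (_ : Fin p-1) → 0#)
      ≡⟨ cong (F 0ᵛ +_) (sum-replicate-zero p-1) ⟩
    F 0ᵛ + 0#
      ≡⟨ +-identityʳ _ ⟩
    F 0ᵛ ∎

  -- Monomials and a degree bound by duality.

  monomial : ∀ {k} → Vec ℕ k → Vec ℤₚ k → ℤₚ
  monomial []       []      = 1#
  monomial (e ∷ es) (y ∷ v) = y ^ e * monomial es v

  monomial-suc : ∀ {k} (es : Vec ℕ k) i v →
                 monomial (es [ i ]%= suc) v ≡ lookup v i * monomial es v
  monomial-suc (e ∷ es) zero    (y ∷ v) = *-assoc y (y ^ e) (monomial es v)
  monomial-suc (e ∷ es) (suc i) (y ∷ v) =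
    trans (cong (y ^ e *_) (monomial-suc es i v)) (*-swap (y ^ e) _ _)

  monomial-0 : ∀ {k} (v : Vec ℤₚ k) → monomial (replicate _ 0) v ≡ 1#
  monomial-0 []      = refl
  monomial-0 (y ∷ v) = trans (*-identityˡ _) (monomial-0 v)

  sum-suc : ∀ {k} (es : Vec ℕ k) i → Vec.sum (es [ i ]%= suc) ≡ suc (Vec.sum es)
  sum-suc (e ∷ es) zero    = refl
  sum-suc (e ∷ es) (suc i) = trans (cong (e ℕ.+_) (sum-suc es i)) (ℕ.+-suc e _)

  sum-0 : ∀ k → Vec.sum (replicate k 0) ≡ 0
  sum-0 zero    = refl
  sum-0 (suc k) = sum-0 k

  -- The sum factors into one power sum per coordinate. If every exponent were at least `p-1`, their
  -- total would reach `k ℕ.* p-1`; so some exponent is smaller, and its power sum vanishes. The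
  -- recursion looks for this exponent, giving up at least `p-1` of the total at each coordinate it
  -- passes.
  monomial-vanishes : ∀ {k} (es : Vec ℕ k) → Vec.sum es < k ℕ.* p-1 → ∑ᵛ (monomial es) ≡ 0#
  monomial-vanishes {suc k} (e ∷ es) small = begin
    sum (λ y → ∑ᵛ λ v → y ^ e * monomial es v)   ≡⟨ sum-cong-≗ (λ y → ∑ᵛ-* (y ^ e) (monomial es)) ⟩
    sum (λ y → y ^ e * ∑ᵛ (monomial es))         ≡⟨ *-distribʳ-sum _ (_^ e) ⟨
    sum (_^ e) * ∑ᵛ (monomial es)                ≡⟨ factor (e ℕ.<? p-1) ⟩
    0#                                           ∎
    where
    factor : Dec (e < p-1) → sum (_^ e) * ∑ᵛ (monomial es) ≡ 0#
    factor (yes e<p-1) = trans (cong (_* ∑ᵛ (monomial es)) (power-sum e<p-1)) (zeroˡ _)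
    factor (no  e≮p-1) = trans (cong (sum (_^ e) *_) (monomial-vanishes es small′)) (zeroʳ _)
      where
      small′ : Vec.sum es < k ℕ.* p-1
      small′ = ℕ.+-cancelˡ-< p-1 _ _
        (ℕ.≤-<-trans (ℕ.+-monoˡ-≤ (Vec.sum es) (ℕ.≮⇒≥ e≮p-1)) small)

  -- Holds when F is a polynomial function of degree at most d; closure under
  -- sums and multiplication by variables spares a type of polynomials.
  Degree≤ : ∀ {k} → ℕ → (Vec ℤₚ k → ℤₚ) → Set
  Degree≤ {k} d F = ∀ es → Vec.sum es ℕ.+ d < k ℕ.* p-1 → ∑ᵛ (λ v → monomial es v * F v) ≡ 0#

  module _ {k : ℕ} where

    Degree≤-cong : ∀ {d} {F G : Vec ℤₚ k → ℤₚ} → F ≗ G → Degree≤ d F → Degree≤ d G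
    Degree≤-cong F≗G D es small =
      trans (∑ᵛ-cong λ v → cong (monomial es v *_) (sym (F≗G v))) (D es small)

    Degree≤-weaken : ∀ {d e} {F : Vec ℤₚ k → ℤₚ} → d ≤ e → Degree≤ d F → Degree≤ e F
    Degree≤-weaken d≤e D es small = D es (ℕ.≤-<-trans (ℕ.+-monoʳ-≤ (Vec.sum es) d≤e) small)

    Degree≤-1 : Degree≤ {k} 0 (λ _ → 1#)
    Degree≤-1 es small = trans (∑ᵛ-cong λ v → *-identityʳ (monomial es v))
      (monomial-vanishes es (subst (_< k ℕ.* p-1) (ℕ.+-identityʳ _) small))

    Degree≤-0 : ∀ {d} → Degree≤ {k} d (λ _ → 0#)
    Degree≤-0 es _ = ∑ᵛ-0 λ v → zeroʳ (monomial es v)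

    Degree≤-+ : ∀ {d} {F G : Vec ℤₚ k → ℤₚ} →
                Degree≤ d F → Degree≤ d G → Degree≤ d (λ v → F v + G v)
    Degree≤-+ {F = F} {G} DF DG es small = begin
      ∑ᵛ (λ v → monomial es v * (F v + G v))
        ≡⟨ ∑ᵛ-cong (λ v → distribˡ (monomial es v) (F v) (G v)) ⟩
      ∑ᵛ (λ v → monomial es v * F v + monomial es v * G v)
        ≡⟨ ∑ᵛ-+ (λ v → monomial es v * F v) (λ v → monomial es v * G v) ⟩
      ∑ᵛ (λ v → monomial es v * F v) + ∑ᵛ (λ v → monomial es v * G v)
        ≡⟨ cong₂ _+_ (DF es small) (DG es small) ⟩
      0# + 0#
        ≡⟨ +-identityˡ 0# ⟩
      0# ∎

    Degree≤-sum : ∀ {d m} {F : Fin m → Vec ℤₚ k → ℤₚ} →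
                  (∀ i → Degree≤ d (F i)) → Degree≤ d (λ v → sum λ i → F i v)
    Degree≤-sum {m = zero}  D = Degree≤-0
    Degree≤-sum {m = suc m} D = Degree≤-+ (D zero) (Degree≤-sum (D ∘ suc))

    Degree≤-* : ∀ {d} c {F : Vec ℤₚ k → ℤₚ} → Degree≤ d F → Degree≤ d (λ v → c * F v)
    Degree≤-* c {F} D es small = begin
      ∑ᵛ (λ v → monomial es v * (c * F v))   ≡⟨ ∑ᵛ-cong (λ v → *-swap (monomial es v) c (F v)) ⟩
      ∑ᵛ (λ v → c * (monomial es v * F v))   ≡⟨ ∑ᵛ-* c (λ v → monomial es v * F v) ⟩
      c * ∑ᵛ (λ v → monomial es v * F v)     ≡⟨ cong (c *_) (D es small) ⟩
      c * 0#                                 ≡⟨ zeroʳ c ⟩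
      0#                                     ∎

    -- The new factor is absorbed into the test monomial, whose total exponent grows by one. This is
    -- why `Degree≤` quantifies over all `es`.
    Degree≤-variable : ∀ {d} i {F : Vec ℤₚ k → ℤₚ} →
                       Degree≤ d F → Degree≤ (suc d) (λ v → lookup v i * F v)
    Degree≤-variable {d} i {F} D es small = trans (∑ᵛ-cong step) (D (es [ i ]%= suc) small′)
      where
      small′ : Vec.sum (es [ i ]%= suc) ℕ.+ d < k ℕ.* p-1
      small′ = subst (_< k ℕ.* p-1)
        (trans (ℕ.+-suc _ d) (cong (ℕ._+ d) (sym (sum-suc es i)))) small

      step : ∀ v → monomial es v * (lookup v i * F v) ≡ monomial (es [ i ]%= suc) v * F v
      step v = begin
        monomial es v * (lookup v i * F v)   ≡⟨ *-swap (monomial es v) (lookup v i) (F v) ⟩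
        lookup v i * (monomial es v * F v)   ≡⟨ *-assoc _ _ _ ⟨
        lookup v i * monomial es v * F v     ≡⟨ cong (_* F v) (monomial-suc es i v) ⟨
        monomial (es [ i ]%= suc) v * F v    ∎

  -- Diagonal quadratic forms and the Chevalley-Warning theorem.

  quadric : ∀ {k} → Vec ℤₚ k → Vec ℤₚ k → ℤₚ
  quadric cs v = sum λ i → lookup v i * lookup v i * lookup cs i

  -- The closure properties cover multiplication by one variable at a time, not products of two
  -- functions. Hence an arbitrary cofactor `F` is carried along here and below, and products are
  -- built up factor by factor.
  Degree≤-quadric : ∀ {k d} cs {F : Vec ℤₚ k → ℤₚ} →
                    Degree≤ d F → Degree≤ (2+ d) (λ v → quadric cs v * F v)
  Degree≤-quadric cs {F} D =
    Degree≤-cong (λ v → trans (sum-cong-≗ λ i → reassociate (lookup v i) (lookup cs i) (F v))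
                              (sym (*-distribʳ-sum (F v) λ i → lookup v i * lookup v i * lookup cs i)))
      (Degree≤-sum {F = λ i v → lookup v i * (lookup v i * (lookup cs i * F v))}
        λ i → Degree≤-variable i (Degree≤-variable i (Degree≤-* (lookup cs i) D)))
    where
    reassociate : ∀ y c f → y * (y * (c * f)) ≡ y * y * c * f
    reassociate y c f = trans (sym (*-assoc y y (c * f))) (sym (*-assoc (y * y) c f))

  Degree≤-quadric-^ : ∀ {k d} cs m {F : Vec ℤₚ k → ℤₚ} →
                      Degree≤ d F → Degree≤ (m ℕ.* 2 ℕ.+ d) (λ v → quadric cs v ^ m * F v)
  Degree≤-quadric-^ cs zero    {F} D = Degree≤-cong (λ v → sym (*-identityˡ (F v))) D
  Degree≤-quadric-^ cs (suc m) {F} D =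
    Degree≤-cong (λ v → sym (*-assoc (quadric cs v) _ (F v)))
      (Degree≤-quadric cs (Degree≤-quadric-^ cs m D))

  -- By Fermat, δ is the indicator function of 0.
  δ : ℤₚ → ℤₚ
  δ x = 1# + - 1# * x ^ p-1

  δ-0 : δ 0# ≡ 1#
  δ-0 = begin
    1# + - 1# * (0# * 0# ^ n)    ≡⟨ cong (λ z → 1# + - 1# * z) (zeroˡ (0# ^ n)) ⟩
    1# + - 1# * 0#               ≡⟨ cong (1# +_) (zeroʳ (- 1#)) ⟩
    1# + 0#                      ≡⟨ +-identityʳ 1# ⟩
    1#                           ∎

  δ-≢0 : ∀ {x} → x ≢ 0# → δ x ≡ 0#
  δ-≢0 {x} x≢0 = begin
    1# + - 1# * x ^ p-1          ≡⟨ cong (λ z → 1# + - 1# * z) (fermat x x≢0) ⟩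
    1# + - 1# * 1#               ≡⟨ cong (1# +_) (*-identityʳ (- 1#)) ⟩
    1# + - 1#                    ≡⟨ -‿inverseʳ 1# ⟩
    0#                           ∎

  Degree≤-δ : ∀ {k d} cs {F : Vec ℤₚ k → ℤₚ} →
              Degree≤ d F → Degree≤ (p-1 ℕ.* 2 ℕ.+ d) (λ v → δ (quadric cs v) * F v)
  Degree≤-δ {d = d} cs {F} D = Degree≤-cong expand
    (Degree≤-+ (Degree≤-weaken (ℕ.m≤n+m d (p-1 ℕ.* 2)) D)
               (Degree≤-* (- 1#) (Degree≤-quadric-^ cs p-1 D)))
    where
    expand : ∀ v → F v + - 1# * (quadric cs v ^ p-1 * F v) ≡ δ (quadric cs v) * F v
    expand v = begin
      F v + - 1# * (q * F v)         ≡⟨ cong₂ _+_ (*-identityˡ (F v)) (*-assoc (- 1#) q (F v)) ⟨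
      1# * F v + - 1# * q * F v      ≡⟨ distribʳ (F v) 1# (- 1# * q) ⟨
      (1# + - 1# * q) * F v          ∎
      where q = quadric cs v ^ p-1

  quadric-0 : ∀ {k} (cs : Vec ℤₚ k) → quadric cs 0ᵛ ≡ 0#
  quadric-0 []       = refl
  quadric-0 (c ∷ cs) = begin
    0# * 0# * c + quadric cs 0ᵛ  ≡⟨ cong₂ _+_ (trans (*-assoc 0# 0# c) (zeroˡ _)) (quadric-0 cs) ⟩
    0# + 0#                      ≡⟨ +-identityˡ 0# ⟩
    0#                           ∎

  -- Exhaustive search over the finitely many vectors, so that a common zero can be obtained from
  -- the refutation of its absence.
  any?ᵛ : ∀ {k} {P : Vec ℤₚ k → Set} → (∀ v → Dec (P v)) → Dec (∃ P)
  any?ᵛ {zero}  P? = map′ ([] ,_) (λ { ([] , p) → p }) (P? [])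
  any?ᵛ {suc k} P? =
    map′ (λ { (y , v , p) → y ∷ v , p }) (λ { (y ∷ v , p) → y , v , p })
         (any? λ y → any?ᵛ λ v → P? (y ∷ v))

  _≟ᵛ_ : ∀ {k} (v w : Vec ℤₚ k) → Dec (v ≡ w)
  _≟ᵛ_ = ≡-dec _≟_

  CommonZero : ∀ {k} → Vec ℤₚ k → Vec ℤₚ k → Vec ℤₚ k → Set
  CommonZero cs ds v = v ≢ 0ᵛ × quadric cs v ≡ 0# × quadric ds v ≡ 0#

  -- Without a common zero, δ (quadric cs v) * (δ (quadric ds v) * 1#) would be
  -- the indicator function of 0ᵛ, whose sum is 1, but its degree is too small.
  chevalley-warning : ∀ {k} → 4 < k → (cs ds : Vec ℤₚ k) → ∃ (CommonZero cs ds)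
  chevalley-warning {k} 4<k cs ds = decidable-stable (any?ᵛ commonZero?) λ ¬∃ →
    1≢0 (begin
      1#                                               ≡⟨ F-0 ⟨
      F 0ᵛ                                             ≡⟨ ∑ᵛ-supported-at-0 (supported ¬∃) ⟨
      ∑ᵛ F                                             ≡⟨ ∑ᵛ-cong (λ v → *-identityˡ (F v)) ⟨
      ∑ᵛ (λ v → 1# * F v)                              ≡⟨ ∑ᵛ-cong (λ v → cong (_* F v) (monomial-0 v)) ⟨
      ∑ᵛ (λ v → monomial (replicate _ 0) v * F v)      ≡⟨ degree (replicate _ 0) small ⟩
      0#                                               ∎)
    where
    commonZero? : ∀ v → Dec (CommonZero cs ds v)
    commonZero? v = ¬? (v ≟ᵛ 0ᵛ) ×-dec quadric cs v ≟ 0# ×-dec quadric ds v ≟ 0#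

    -- The trailing `1#` is the cofactor of degree 0 from which two uses of `Degree≤-δ` start.
    F : Vec ℤₚ k → ℤₚ
    F v = δ (quadric cs v) * (δ (quadric ds v) * 1#)

    d : ℕ
    d = p-1 ℕ.* 2 ℕ.+ (p-1 ℕ.* 2 ℕ.+ 0)

    degree : Degree≤ d F
    degree = Degree≤-δ cs (Degree≤-δ ds Degree≤-1)

    d≡4*p-1 : d ≡ 4 ℕ.* p-1
    d≡4*p-1 = trans (cong (λ z → p-1 ℕ.* 2 ℕ.+ z) (ℕ.+-identityʳ _))
      (trans (sym (ℕ.*-distribˡ-+ p-1 2 2)) (ℕ.*-comm p-1 4))

    -- Each form contributes 2 (p - 1) to the degree, 4 (p - 1) in all, which stays below k (p - 1)
    -- because `4 < k`.
    small : Vec.sum (replicate k 0) ℕ.+ d < k ℕ.* p-1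
    small = subst (_< k ℕ.* p-1) (sym (cong₂ ℕ._+_ (sum-0 k) d≡4*p-1)) (ℕ.*-monoˡ-< p-1 4<k)

    F-0 : F 0ᵛ ≡ 1#
    F-0 = begin
      F 0ᵛ                 ≡⟨ cong₂ (λ x y → δ x * (δ y * 1#)) (quadric-0 cs) (quadric-0 ds) ⟩
      δ 0# * (δ 0# * 1#)   ≡⟨ cong (λ x → x * (x * 1#)) δ-0 ⟩
      1# * (1# * 1#)       ≡⟨ trans (*-identityˡ _) (*-identityˡ _) ⟩
      1#                   ∎

    supported : ¬ ∃ (CommonZero cs ds) → ∀ v → v ≢ 0ᵛ → F v ≡ 0#
    supported ¬∃ v v≢0 with quadric cs v ≟ 0# | quadric ds v ≟ 0#
    ... | yes c≡0 | yes d≡0 = contradiction (v , v≢0 , c≡0 , d≡0) ¬∃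
    ... | no  c≢0 | _       = trans (cong (_* (δ (quadric ds v) * 1#)) (δ-≢0 c≢0)) (zeroˡ _)
    ... | yes _   | no  d≢0 = begin
      F v                               ≡⟨ cong (λ x → δ (quadric cs v) * (x * 1#)) (δ-≢0 d≢0) ⟩
      δ (quadric cs v) * (0# * 1#)      ≡⟨ cong (δ (quadric cs v) *_) (zeroˡ 1#) ⟩
      δ (quadric cs v) * 0#             ≡⟨ zeroʳ _ ⟩
      0#                                ∎

  -- Anisotropy of x² + y² when (p - 1)/2 is odd.

  odd-powers : ∀ a b k → a + b ≡ 0# → a ^ (1 ℕ.+ 2 ℕ.* k) + b ^ (1 ℕ.+ 2 ℕ.* k) ≡ 0#
  odd-powers a b k a+b≡0 = begin
    a * a ^ (2 ℕ.* k) + b * b ^ (2 ℕ.* k)     ≡⟨ cong₂ (λ x y → a * x + b * y) (^-assocʳ a 2 k) (^-assocʳ b 2 k) ⟨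
    a * (a ^ 2) ^ k + b * (b ^ 2) ^ k         ≡⟨ cong (λ x → a * (a ^ 2) ^ k + b * x ^ k) a²≡b² ⟨
    a * (a ^ 2) ^ k + b * (a ^ 2) ^ k         ≡⟨ distribʳ _ a b ⟨
    (a + b) * (a ^ 2) ^ k                     ≡⟨ cong (_* (a ^ 2) ^ k) a+b≡0 ⟩
    0# * (a ^ 2) ^ k                          ≡⟨ zeroˡ _ ⟩
    0#                                        ∎
    where
    -- As `b` is the negative of `a`, their even powers agree, which lets `a + b` be factored out
    -- above. Adding `a * b` to either square gives a multiple of `a + b`, hence 0.
    a²≡b² : a ^ 2 ≡ b ^ 2
    a²≡b² = begin
      a * (a * 1#)    ≡⟨ cong (a *_) (*-identityʳ a) ⟩
      a * a           ≡⟨ +-cancelˡ (a * b) _ _ ab+a²≡ab+b² ⟩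
      b * b           ≡⟨ cong (b *_) (*-identityʳ b) ⟨
      b * (b * 1#)    ∎
      where
      ab+a²≡ab+b² : a * b + a * a ≡ a * b + b * b
      ab+a²≡ab+b² = begin
        a * b + a * a   ≡⟨ +-comm (a * b) (a * a) ⟩
        a * a + a * b   ≡⟨ distribˡ a a b ⟨
        a * (a + b)     ≡⟨ trans (cong (a *_) a+b≡0) (zeroʳ a) ⟩
        0#              ≡⟨ trans (cong (_* b) a+b≡0) (zeroˡ b) ⟨
        (a + b) * b     ≡⟨ distribʳ b a b ⟩
        a * b + b * b   ∎

  module _ (k : ℕ) (p-1≡2[1+2k] : p-1 ≡ 2 ℕ.* (1 ℕ.+ 2 ℕ.* k)) (1+1≢0 : 1# + 1# ≢ 0#) where

    -- If `x` is non-zero, so is `y`, since otherwise x² = 0. With h = (p - 1)/2, Fermat gives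
    -- (x²)^h = (y²)^h = 1. As h is odd and x² = -y², these powers also add up to 0, so 2 = 0.
    squares-anisotropicˡ : ∀ {x y} → x * x + y * y ≡ 0# → x ≡ 0#
    squares-anisotropicˡ {x} {y} x²+y²≡0 = decidable-stable (x ≟ 0#) λ x≢0 →
      1+1≢0 (begin
        1# + 1#                      ≡⟨ cong₂ _+_ (even-power x≢0) (even-power (y≢0 x≢0)) ⟨
        (x * x) ^ h + (y * y) ^ h    ≡⟨ odd-powers (x * x) (y * y) k x²+y²≡0 ⟩
        0#                           ∎)
      where
      h = 1 ℕ.+ 2 ℕ.* k

      even-power : ∀ {z} → z ≢ 0# → (z * z) ^ h ≡ 1#
      even-power {z} z≢0 = begin
        (z * z) ^ h         ≡⟨ cong (λ w → (z * w) ^ h) (*-identityʳ z) ⟨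
        (z ^ 2) ^ h         ≡⟨ ^-assocʳ z 2 h ⟩
        z ^ (2 ℕ.* h)       ≡⟨ cong (z ^_) p-1≡2[1+2k] ⟨
        z ^ p-1             ≡⟨ fermat z z≢0 ⟩
        1#                  ∎

      y≢0 : x ≢ 0# → y ≢ 0#
      y≢0 x≢0 refl = x≢0 (x*y≡0⇒y≡0 x≢0
        (trans (sym (trans (cong (x * x +_) (zeroˡ 0#)) (+-identityʳ _))) x²+y²≡0))

    squares-anisotropicʳ : ∀ {x y} → x * x + y * y ≡ 0# → y ≡ 0#
    squares-anisotropicʳ eq = squares-anisotropicˡ (trans (+-comm _ _) eq)

    -- The two conditions read c² + d² = 0 and a² + b² + c² + d² = 0.
    ¬commonZero-0011 : ¬ ∃ (CommonZero (0# ∷ 0# ∷ 1# ∷ 1# ∷ []) 1ᵛ)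
    ¬commonZero-0011 (a ∷ b ∷ c ∷ d ∷ [] , v≢0 , q₁ , q₂) = v≢0 v≡0
      where
      *1+*1+0 : ∀ x y → x * x * 1# + (y * y * 1# + 0#) ≡ x * x + y * y
      *1+*1+0 x y = cong₂ _+_ (*-identityʳ (x * x))
        (trans (+-identityʳ (y * y * 1#)) (*-identityʳ (y * y)))

      c²+d²≡0 : c * c + d * d ≡ 0#
      c²+d²≡0 = begin
        c * c + d * d                            ≡⟨ *1+*1+0 c d ⟨
        r                                        ≡⟨ trans (+-identityˡ (0# + r)) (+-identityˡ r) ⟨
        0# + (0# + r)                            ≡⟨ cong₂ (λ x y → x + (y + r)) (zeroʳ (a * a)) (zeroʳ (b * b)) ⟨
        a * a * 0# + (b * b * 0# + r)            ≡⟨ q₁ ⟩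
        0#                                       ∎
        where r = c * c * 1# + (d * d * 1# + 0#)

      a²+b²≡0 : a * a + b * b ≡ 0#
      a²+b²≡0 = begin
        a * a + b * b                                      ≡⟨ *1+*1+0 a b ⟨
        a * a * 1# + (b * b * 1# + 0#)                     ≡⟨ cong (λ z → a * a * 1# + (b * b * 1# + z))
                                                                (trans (*1+*1+0 c d) c²+d²≡0) ⟨
        a * a * 1# + (b * b * 1# + (c * c * 1# + (d * d * 1# + 0#)))  ≡⟨ q₂ ⟩
        0#                                                 ∎

      v≡0 : a ∷ b ∷ c ∷ d ∷ [] ≡ 0ᵛ
      v≡0 = cong₂ _∷_ (squares-anisotropicˡ a²+b²≡0) (cong₂ _∷_ (squares-anisotropicʳ a²+b²≡0)
              (cong₂ _∷_ (squares-anisotropicˡ c²+d²≡0) (cong₂ _∷_ (squares-anisotropicʳ c²+d²≡0) refl)))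

-- Weighted zero-sum subsequences as common zeros.

module PrimeField (n : ℕ) (prime : Prime (2+ n)) where

  1≢0 : Mod.1# (2+ n) ≢ Mod.0# (2+ n)
  1≢0 ()

  open PrimeResidues n prime using (inverse; characteristic)
  open FiniteField (CommutativeRing.isCommutativeRing (Residues.commutativeRing (2+ n)))
    1≢0 inverse characteristic
  open ≡-Reasoning
  open Mod p using (U; Q; HasWeightedZeroSumSubsequence; EverySequenceOfLength; IsD)

  square-Q : ∀ {y} → y ≢ 0# → Q (y * y)
  square-Q {y} y≢0 = y , inverse y y≢0 , refl

  unit-≢0 : ∀ {y} → U y → y ≢ 0#
  unit-≢0 (z , yz≡1) refl = 1≢0 (trans (sym yz≡1) (zeroˡ z))

  zero-term : ∀ c z → 0# * 0# * c + z ≡ z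
  zero-term c z = trans (cong (_+ z) (trans (*-assoc 0# 0# c) (zeroˡ (0# * c)))) (+-identityˡ z)

  -- The intended `v` has square roots of the weights as its non-zero entries and 0 at the omitted
  -- terms; only the resulting values of the two forms are recorded.
  Weighted : ∀ {k m} → Vec ℤₚ k → Vec ℤₚ k → Vec ℤₚ m → Vec ℤₚ m → Set
  Weighted xs v ys as =
    toList ys ⊆ toList xs × All Q as ×
    Mod.sum p (zipWith _*_ as ys) ≡ quadric xs v ×
    Mod.sum p as ≡ quadric 1ᵛ v

  -- A term with coordinate 0 is dropped; any other coordinate `y` is a unit, and the term is kept
  -- with weight `y * y`. A non-zero `v` thus keeps at least one term.
  toWeighted : ∀ {k} (xs v : Vec ℤₚ k) → ∃ λ m → ∃ λ (ys : Vec ℤₚ m) → ∃ λ as →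
               Weighted xs v ys as × (v ≢ 0ᵛ → 1 ≤ m)
  toWeighted []       []      = 0 , [] , [] , ([] , [] , refl , refl) , λ []≢[] → contradiction refl []≢[]
  toWeighted (x ∷ xs) (y ∷ v) with toWeighted xs v | y ≟ 0#
  ... | m , ys , as , (ys⊆xs , as∈Q , eq₁ , eq₂) , m≥1 | yes refl =
    m , ys , as ,
    (x ∷ʳ ys⊆xs , as∈Q , trans eq₁ (sym (zero-term x _)) , trans eq₂ (sym (zero-term 1# _))) ,
    λ 0∷v≢0 → m≥1 (0∷v≢0 ∘ cong (0# ∷_))
  ... | m , ys , as , (ys⊆xs , as∈Q , eq₁ , eq₂) , _   | no y≢0 =
    suc m , x ∷ ys , y * y ∷ as ,
    (refl ∷ ys⊆xs , square-Q y≢0 ∷ as∈Q , cong (y * y * x +_) eq₁ ,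
     cong₂ _+_ (sym (*-identityʳ (y * y))) eq₂) ,
    λ _ → s≤s z≤n

  FromWeighted : ∀ {k m} → Vec ℤₚ k → Vec ℤₚ m → Vec ℤₚ m → Set
  FromWeighted {m = m} xs ys as = ∃ λ v → Weighted xs v ys as × (1 ≤ m → v ≢ 0ᵛ)

  fromWeighted-skip : ∀ {k m} {xs : Vec ℤₚ k} {ys as : Vec ℤₚ m} x →
                      FromWeighted xs ys as → FromWeighted (x ∷ xs) ys as
  fromWeighted-skip x (v , (ys⊆xs , as∈Q , eq₁ , eq₂) , v≢0) =
    0# ∷ v ,
    (x ∷ʳ ys⊆xs , as∈Q , trans eq₁ (sym (zero-term x _)) , trans eq₂ (sym (zero-term 1# _))) ,
    λ 1≤m → v≢0 1≤m ∘ ∷-injectiveʳ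

  -- Recursion on the embedding: a skipped term gets coordinate 0, a kept one the square root
  -- supplied by `Q`. That root is a unit, so one kept term already makes `v` non-zero.
  fromWeighted : ∀ {k m} (xs : Vec ℤₚ k) (ys as : Vec ℤₚ m) →
                 toList ys ⊆ toList xs → All Q as → FromWeighted xs ys as
  fromWeighted [] [] [] [] [] = [] , ([] , [] , refl , refl) , λ ()
  -- The skip case is split by the shape of `ys` because `toList ys` has to reduce before the
  -- embedding can be matched.
  fromWeighted (x ∷ xs) [] [] (_ ∷ʳ []⊆xs) [] =
    fromWeighted-skip x (fromWeighted xs [] [] []⊆xs [])
  fromWeighted (x ∷ xs) ys@(_ ∷ _) as (_ ∷ʳ ys⊆xs) as∈Q =
    fromWeighted-skip x (fromWeighted xs ys as ys⊆xs as∈Q)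
  fromWeighted (x ∷ xs) (_ ∷ ys) (_ ∷ as) (refl ∷ ys⊆xs) (a∈Q@(y , y∈U , refl) ∷ as∈Q)
    with v , (_ , _ , eq₁ , eq₂) , _ ← fromWeighted xs ys as ys⊆xs as∈Q =
    y ∷ v ,
    (refl ∷ ys⊆xs , a∈Q ∷ as∈Q , cong (y * y * x +_) eq₁ ,
     cong₂ _+_ (sym (*-identityʳ (y * y))) eq₂) ,
    λ _ → unit-≢0 y∈U ∘ ∷-injectiveˡ

  commonZero⇒subsequence : ∀ {k} {xs : Vec ℤₚ k} →
                           ∃ (CommonZero xs 1ᵛ) → HasWeightedZeroSumSubsequence xs
  commonZero⇒subsequence {xs = xs} (v , v≢0 , q₁ , q₂)
    with m , ys , as , (ys⊆xs , as∈Q , eq₁ , eq₂) , m≥1 ← toWeighted xs v =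
    m , ys , m≥1 v≢0 , ys⊆xs , as , as∈Q , trans eq₁ q₁ , trans eq₂ q₂

  subsequence⇒commonZero : ∀ {k} {xs : Vec ℤₚ k} →
                           HasWeightedZeroSumSubsequence xs → ∃ (CommonZero xs 1ᵛ)
  subsequence⇒commonZero {xs = xs} (m , ys , 1≤m , ys⊆xs , as , as∈Q , z₁ , z₂)
    with v , (_ , _ , eq₁ , eq₂) , v≢0 ← fromWeighted xs ys as ys⊆xs as∈Q =
    v , v≢0 1≤m , trans (sym eq₁) z₁ , trans (sym eq₂) z₂

  everySequence-suc : ∀ {k} → EverySequenceOfLength k → EverySequenceOfLength (suc k)
  everySequence-suc every (x ∷ xs) with m , ys , 1≤m , ys⊆xs , wzs ← every xs =
    m , ys , 1≤m , x ∷ʳ ys⊆xs , wzs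

  -- Reduces minimality to the single length 4: a smaller length that worked would make 4 work too.
  everySequence-mono : ∀ {k l} → k ≤′ l → EverySequenceOfLength k → EverySequenceOfLength l
  everySequence-mono ≤′-refl       every = every
  everySequence-mono (≤′-step k≤l) every = everySequence-suc (everySequence-mono k≤l every)

  -- The value of the constant for `p` congruent to 3 modulo 4.

  module _ (p≡3mod4 : p % 4 ≡ 3) where

    1+1≢0 : 1# + 1# ≢ 0#
    1+1≢0 = 2≢0 n p≡3mod4
      where
      -- The case `m` = 0, modulus 2, contradicts the residue modulo 4. From modulus 3 on, 1 + 1
      -- computes to a successor.
      2≢0 : ∀ m → (2+ m) % 4 ≡ 3 → Mod._+_ (2+ m) (Mod.1# (2+ m)) (Mod.1# (2+ m)) ≢ zero
      2≢0 (suc m) _ ()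

    -- Writing p = 4 q + 3 gives p - 1 = 2 (2 q + 1), so (p - 1)/2 is odd.
    p-1≡2[1+2k] : p-1 ≡ 2 ℕ.* (1 ℕ.+ 2 ℕ.* (p / 4))
    p-1≡2[1+2k] = ℕ.suc-injective (begin
      p                                        ≡⟨ m≡m%n+[m/n]*n p 4 ⟩
      p % 4 ℕ.+ p / 4 ℕ.* 4                    ≡⟨ cong₂ ℕ._+_ p≡3mod4 (ℕ.*-comm (p / 4) 4) ⟩
      3 ℕ.+ 4 ℕ.* (p / 4)                      ≡⟨ cong (3 ℕ.+_) (ℕ.*-assoc 2 2 (p / 4)) ⟩
      3 ℕ.+ 2 ℕ.* (2 ℕ.* (p / 4))              ≡⟨ cong suc (ℕ.*-distribˡ-+ 2 1 (2 ℕ.* (p / 4))) ⟨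
      suc (2 ℕ.* (1 ℕ.+ 2 ℕ.* (p / 4)))        ∎)

    ¬everySequence-4 : ¬ EverySequenceOfLength 4
    ¬everySequence-4 every = ¬commonZero-0011 (p / 4) p-1≡2[1+2k] 1+1≢0
      (subsequence⇒commonZero (every (0# ∷ 0# ∷ 1# ∷ 1# ∷ [])))

    isD-5 : IsD 5
    isD-5 = s≤s z≤n
          -- Here `ℕ.≤-refl` proves 4 < 5: five variables exceed the total degree of the two forms.
          , (λ xs → commonZero⇒subsequence (chevalley-warning ℕ.≤-refl xs 1ᵛ))
          , λ k _ every → ℕ.≰⇒> λ k≤4 → ¬everySequence-4 (everySequence-mono (ℕ.≤⇒≤′ k≤4) every)

theorem4p3 : (p : ℕ) .{{_ : NonZero p}} → Prime p → ¬ (2 ∣ p) → p % 4 ≡ 3 → Mod.IsD p 5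
theorem4p3 0      pr _ _ = contradiction pr ¬prime[0]
theorem4p3 1      pr _ _ = contradiction pr ¬prime[1]
theorem4p3 (2+ n) pr _ p≡3mod4 = PrimeField.isD-5 n pr p≡3mod4
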